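{- Let $G$ be a connected graph and let $(G,X,H,f)$ be an uncolorable degree-feasible configuration. Then the following statements hold: (a) $\sum_{x\in X_u}f(x)=d_G(u)$ for all $u\in V(G)$. (b) If $v\in V(G)$ is not a separating vertex of $G$ and $x_v\in X_v$ satisfies $f(x_v)>0$, then, for every $u\in V(G-v)$, we have $f(y)\ge\mu_H(y,x_v)$ for all $y\in X_u$ and $\mu_G(v,u)=\sum_{y\in X_u}\mu_H(y,x_v)$. (c) If $|G|\ge 2$ and $u$ is an arbitrary vertex of $G$, then there is a partial transversal $T$ of $(X,H)$ such that $\mathrm{dom}(T:G)=V(G-u)$ and $H[T]$ is strictly $f$-degenerate, and, for every such $T$ and every vertex $x\in X_u$, we have $f(x)=d_{H[T\cup\{x\}]}(x)$.
   Context: $\mathbb{N}_0=\{0,1,2,\dots\}$. Graphs are finite, undirected, may have multiple edges, no loops; connected graphs are non-empty. $|G|$ is the number of vertices, $\mu_G(u,v)$ is the number of edges joining $u$ and $v$; $d_G(v)$ is the number of edges incident with $v$. A separating vertex of a connected graph is a vertex whose deletion leaves at least two components. A cover of $G$ is a pair $(X,H)$ where $H$ is a graph and $X$ assigns to each $v\in V(G)$ a set $X_v\subseteq V(H)$ such that the sets $X_v$ are pairwise disjoint, $V(H)=\bigcup_v X_v$, each $X_v$ is independent in $H$, and for distinct $u,v\in V(G)$ the set of edges of $H$ between $X_u$ and $X_v$ is the union of $\mu_G(u,v)$ (possibly empty) matchings of $H$. A transversal of $(X,H)$ is a set $T\subseteq V(H)$ with $|T\cap X_v|=1$ for all $v\in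 V(G)$; a partial transversal satisfies $|T\cap X_v|\le1$ for all $v$; $\mathrm{dom}(T:G)=\{v\in V(G): X_v\cap T\ne\varnothing\}$. A configuration is a tuple $(G,X,H,f)$ where $G$ is a graph, $(X,H)$ is a cover of $G$ and $f:V(H)\to\mathbb{N}_0$. It is degree-feasible if $\sum_{x\in X_v}f(x)\ge d_G(v)$ for all $v\in V(G)$. A subgraph $\tilde H$ of $H$ is strictly $f$-degenerate if each non-empty subgraph $H'$ of $\tilde H$ contains a vertex $x$ with $d_{H'}(x)<f(x)$. The configuration is colorable if $(X,H)$ has a transversal $T$ such that $H[T]$ is strictly $f$-degenerate; otherwise it is uncolorable. -}

module Defs where

open import Data.Bool.Base using (true)
open import Data.Fin.Base using (Fin)
open import Data.Fin.Properties using (_≟_)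
open import Data.Fin.Subset using (Subset; _∈_; _⊆_; ⊤; ∁; ⁅_⁆; _∩_; Nonempty; Empty; ∣_∣)
open import Data.Fin.Subset.Properties using (_∈?_; nonempty?; ∈⊤)
open import Data.List.Base using (allFin; filter; map; sum)
open import Data.Nat.Base using (ℕ; _≤_; _<_; _≥_)
open import Data.Product.Base using (Σ-syntax; ∃-syntax; _×_; _,_; proj₁; proj₂)
open import Data.Sum.Base using (_⊎_)
open import Data.Vec.Base using (tabulate)
open import Data.Vec.Properties using (lookup∘tabulate; []=⇒lookup)
open import Function.Base using (_∘_)
open import Function.Bundles using (_⇔_)
open import Level using (Level)
open import Relation.Binary.Construct.Closure.ReflexiveTransitive using (Star)
open import Relation.Binary.PropositionalEquality using (_≡_; _≢_; trans; sym)
open import Relation.Nullary using (¬_)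
open import Relation.Nullary.Decidable using (Dec; does; yes; no; _×-dec_; _⊎-dec_)
open import Relation.Unary using (Pred; Decidable)

private
  variable
    p : Level
    n : ℕ

select : {P : Pred (Fin n) p} → Decidable P → Subset n
select P? = tabulate (does ∘ P?)

∈-select⁻ : {P : Pred (Fin n) p} (P? : Decidable P) {i : Fin n} → i ∈ select P? → P i
∈-select⁻ {P = P} P? {i} i∈ = witness (P? i) (trans (sym (lookup∘tabulate (does ∘ P?) i)) ([]=⇒lookup i∈))
  where
  witness : (d : Dec (P i)) → does d ≡ true → P i
  witness (yes Pi) _ = Pi
  witness (no _) ()

∑∈ : Subset n → (Fin n → ℕ) → ℕ
∑∈ S g = sum (map g (filter (_∈? S) (allFin _)))

syntax ∑∈ S (λ x → e) = ∑[ x ∈ S ] e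

-- Edges are labelled, so parallel edges are distinct labels with the same
-- ends.  The order in which `src` and `tgt` list the two ends is immaterial:
-- edges are only ever used through the symmetric notions below.
record Graph : Set where
  field
    order    : ℕ
    size     : ℕ
    src tgt  : Fin size → Fin order
    loopless : ∀ e → src e ≢ tgt e

  Vertex : Set
  Vertex = Fin order

  Edge : Set
  Edge = Fin size

  Incident : Edge → Vertex → Set
  Incident e v = src e ≡ v ⊎ tgt e ≡ v

  incident? : ∀ e v → Dec (Incident e v)
  incident? e v = (src e ≟ v) ⊎-dec (tgt e ≟ v)

  Joins : Vertex → Vertex → Edge → Set
  Joins u v e = (src e ≡ u × tgt e ≡ v) ⊎ (src e ≡ v × tgt e ≡ u)

  joins? : ∀ u v e → Dec (Joins u v e)
  joins? u v e = ((src e ≟ u) ×-dec (tgt e ≟ v)) ⊎-dec ((src e ≟ v) ×-dec (tgt e ≟ u))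

  μ : Vertex → Vertex → ℕ
  μ u v = ∣ select (joins? u v) ∣

  Between : Subset order → Subset order → Edge → Set
  Between S T e = (src e ∈ S × tgt e ∈ T) ⊎ (src e ∈ T × tgt e ∈ S)

  Independent : Subset order → Set
  Independent S = ∀ e → ¬ (src e ∈ S × tgt e ∈ S)

  Matching : Subset size → Set
  Matching M = ∀ {e e′} → e ∈ M → e′ ∈ M → e ≢ e′ → ∀ x → ¬ (Incident e x × Incident e′ x)

record Subgraph (G : Graph) : Set where
  open Graph G
  field
    vertices : Subset order
    edges    : Subset size
    closed   : ∀ {e} → e ∈ edges → src e ∈ vertices × tgt e ∈ vertices

open Subgraph public

module _ {G : Graph} where
  open Graph G

  infix 4 _⊑_ _≐_

  _⊑_ : Subgraph G → Subgraph G → Set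
  K ⊑ L = vertices K ⊆ vertices L × edges K ⊆ edges L

  _≐_ : Subgraph G → Subgraph G → Set
  K ≐ L = vertices K ≡ vertices L × edges K ≡ edges L

  degree : Subgraph G → Vertex → ℕ
  degree K v = ∣ select (λ e → (e ∈? edges K) ×-dec incident? e v) ∣

  Adjacent : Subgraph G → Vertex → Vertex → Set
  Adjacent K u v = ∃[ e ] (e ∈ edges K × Joins u v e)

  Connected : Subgraph G → Set
  Connected K = Nonempty (vertices K) ×
    (∀ {u v} → u ∈ vertices K → v ∈ vertices K → Star (Adjacent K) u v)

  -- Maximal connected subgraphs C of K.
  Component : Subgraph G → Subgraph G → Set
  Component K C = C ⊑ K × Connected C ×
    (∀ D → D ⊑ K → Connected D → C ⊑ D → D ≐ C)

  StrictlyDegenerate : (Vertex → ℕ) → Subgraph G → Set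
  StrictlyDegenerate f K = ∀ K′ → K′ ⊑ K → Nonempty (vertices K′) →
    ∃[ x ] (x ∈ vertices K′ × degree K′ x < f x)

module _ (G : Graph) where
  open Graph G

  whole : Subgraph G
  whole = record { vertices = ⊤ ; edges = ⊤ ; closed = λ _ → ∈⊤ , ∈⊤ }

  induced : Subset order → Subgraph G
  induced S = record
    { vertices = S
    ; edges    = select ends∈?
    ; closed   = ∈-select⁻ ends∈?
    }
    where
    ends∈? : ∀ e → Dec (src e ∈ S × tgt e ∈ S)
    ends∈? e = (src e ∈? S) ×-dec (tgt e ∈? S)

  delete : Vertex → Subgraph G
  delete v = induced (∁ ⁅ v ⁆)

  d : Vertex → ℕ
  d = degree whole

  Separating : Vertex → Set
  Separating v = ∃[ C ] ∃[ D ] (Component (delete v) C × Component (delete v) D × ¬ (C ≐ D))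

record IsCover (G H : Graph) (X : Graph.Vertex G → Subset (Graph.order H)) : Set where
  private
    module G = Graph G
    module H = Graph H
  field
    disjoint    : ∀ {u v} → u ≢ v → Empty (X u ∩ X v)
    covering    : ∀ x → ∃[ v ] x ∈ X v
    independent : ∀ v → H.Independent (X v)
    matchings   : ∀ {u v} → u ≢ v →
      Σ[ M ∈ (Fin (G.μ u v) → Subset H.size) ]
        ((∀ i → H.Matching (M i)) ×
         (∀ e → H.Between (X u) (X v) e ⇔ (∃[ i ] e ∈ M i)))

record Configuration : Set where
  field
    G H     : Graph
    X       : Graph.Vertex G → Subset (Graph.order H)
    isCover : IsCover G H X
    f       : Graph.Vertex H → ℕ

  open Graph G public using () renaming (order to ∣G∣; μ to μG)
  open Graph H public using () renaming (order to ∣H∣; μ to μH)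

  DegreeFeasible : Set
  DegreeFeasible = ∀ v → ∑[ x ∈ X v ] f x ≥ d G v

  Transversal : Subset ∣H∣ → Set
  Transversal T = ∀ v → ∣ T ∩ X v ∣ ≡ 1

  PartialTransversal : Subset ∣H∣ → Set
  PartialTransversal T = ∀ v → ∣ T ∩ X v ∣ ≤ 1

  dom : Subset ∣H∣ → Subset ∣G∣
  dom T = select (λ v → nonempty? (X v ∩ T))

  Colorable : Set
  Colorable = ∃[ T ] (Transversal T × StrictlyDegenerate f (induced H T))

  Uncolorable : Set
  Uncolorable = ¬ Colorable

{-# OPTIONS --safe #-}
module Submission where

-- Root G at u and colour the other vertices greedily, each one while some
-- neighbour of it is still uncoloured: the cover has at most μ(v,w) edges from
-- a chosen x ∈ X v to X w, so ∑ f ≥ d(w) leaves a colour of w with fewer chosen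
-- neighbours than f allows.  This gives a degenerate T missing only u.  As T
-- does not extend to u, f x is at most the degree of x in H[T ∪ {x}] for every
-- x ∈ X u, and summing over X u gives
--   d(u) ≤ ∑ f ≤ ∑ deg ≤ ∑ᵥ μ(v,u) = d(u),
-- so all these inequalities are equalities, termwise; this is (a) and (c).
-- For (b), G − v is connected, so the greedy colouring may start from xᵥ.

import Algebra.Properties.Semiring.Sum as SemiringSum
open import Data.Bool.Base using (true; false; if_then_else_)
open import Data.Fin.Base using (Fin; zero; suc)
open import Data.Fin.Properties using (_≟_; any?)
open import Data.Fin.Subset using (Subset; _∈_; _∉_; _⊆_; _⊃_; _∩_; _∪_; ⊤; ⊥; ⁅_⁆; ∣_∣; Nonempty; Empty)
open import Data.Fin.Subset.Induction using (Acc; acc; ⊃-wellFounded)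
open import Data.Fin.Subset.Properties
import Data.List.Base as List
open import Data.Nat.Base using (ℕ; zero; suc; _+_; _*_; _≤_; _<_; _≥_; _>_; z≤n; s≤s)
import Data.Nat.ListAction as ListAction
open import Data.Nat.Properties using (+-*-semiring; +-mono-≤; +-mono-<-≤; +-mono-≤-<; +-identityʳ; *-identityˡ; *-comm; *-assoc; *-monoˡ-≤; *-monoʳ-≤; ≤-refl; ≤-reflexive; ≤-trans; ≤-antisym; <⇒≱; ≮⇒≥; <-irrefl; m≤n+m; m≤m+n; _<?_; module ≤-Reasoning)
open import Data.Product.Base using (_×_; _,_; proj₁; proj₂; ∃-syntax; swap)
open import Data.Sum.Base as Sum using (inj₁; inj₂; [_,_]′)
import Data.Unit.Base as Unit
open import Data.Vec.Base using ([]; _∷_)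
open import Data.Vec.Properties using (lookup∘tabulate; lookup⇒[]=)
open import Function.Base using (_∘_; id)
open import Function.Bundles using (Equivalence)
open import Relation.Binary.Construct.Closure.ReflexiveTransitive using (Star; ε; _◅_; _◅◅_; reverse)
open import Relation.Binary.PropositionalEquality using (_≡_; _≢_; refl; sym; trans; cong; cong₂; subst; module ≡-Reasoning)
open import Relation.Nullary using (¬_; contradiction)
open import Relation.Nullary.Decidable using (Dec; yes; no; does; _×-dec_; ¬?; dec-true)
open import Relation.Unary using (Decidable)
open import Defs

open SemiringSum +-*-semiring using (sum; sum-cong-≗; sum-replicate-zero; ∑-comm; *-distribˡ-sum; *-distribʳ-sum)

private
  variable
    m n : ℕ
    P Q : Set

-- Finite sums and indicators

sum-mono-≤ : (g h : Fin n → ℕ) → (∀ i → g i ≤ h i) → sum g ≤ sum h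
sum-mono-≤ {zero}  g h g≤h = z≤n
sum-mono-≤ {suc n} g h g≤h = +-mono-≤ (g≤h zero) (sum-mono-≤ (g ∘ suc) (h ∘ suc) (g≤h ∘ suc))

sum-mono-< : (g h : Fin n → ℕ) → (∀ i → g i ≤ h i) → ∀ i → g i < h i → sum g < sum h
sum-mono-< g h g≤h zero    gi<hi = +-mono-<-≤ gi<hi (sum-mono-≤ (g ∘ suc) (h ∘ suc) (g≤h ∘ suc))
sum-mono-< g h g≤h (suc i) gi<hi = +-mono-≤-< (g≤h zero) (sum-mono-< (g ∘ suc) (h ∘ suc) (g≤h ∘ suc) i gi<hi)

-- One strict term would already make the total strict. This turns a chain of inequalities between
-- sums that closes up into termwise equalities.
sum-squeeze : (g h : Fin n → ℕ) → (∀ i → g i ≤ h i) → sum h ≤ sum g → ∀ i → g i ≡ h i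
sum-squeeze g h g≤h Σh≤Σg i =
  ≤-antisym (g≤h i) (≮⇒≥ λ gi<hi → <⇒≱ (sum-mono-< g h g≤h i gi<hi) Σh≤Σg)

term≤sum : (g : Fin n → ℕ) → ∀ i → g i ≤ sum g
term≤sum g zero    = m≤m+n (g zero) _
term≤sum g (suc i) = ≤-trans (term≤sum (g ∘ suc) i) (m≤n+m _ (g zero))

sum-zero : (g : Fin n → ℕ) → (∀ i → g i ≡ 0) → sum g ≡ 0
sum-zero {n} g g≡0 = trans (sum-cong-≗ g≡0) (sum-replicate-zero n)

sum-single : (g : Fin n → ℕ) → ∀ j → (∀ i → i ≢ j → g i ≡ 0) → sum g ≡ g j
sum-single g zero    g≡0 =
  trans (cong (g zero +_) (sum-zero (g ∘ suc) λ i → g≡0 (suc i) λ ())) (+-identityʳ (g zero))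
sum-single g (suc j) g≡0 =
  cong₂ _+_ (g≡0 zero λ ()) (sum-single (g ∘ suc) j λ i i≢j → g≡0 (suc i) λ { refl → i≢j refl })

sum-ones : ∀ n → sum {n} (λ _ → 1) ≡ n
sum-ones zero    = refl
sum-ones (suc n) = cong suc (sum-ones n)

-- Indicators rewrite cardinalities, degrees and restricted sums as sums over a full `Fin n`, where
-- the order of summation can be exchanged by `∑-comm`.
𝟙 : Dec P → ℕ
𝟙 P? = if does P? then 1 else 0

𝟙-yes : (P? : Dec P) → P → 𝟙 P? ≡ 1
𝟙-yes (yes _) _ = refl
𝟙-yes (no ¬p) p = contradiction p ¬p

𝟙-no : (P? : Dec P) → ¬ P → 𝟙 P? ≡ 0
𝟙-no (yes p) ¬p = contradiction p ¬p
𝟙-no (no _)  _  = refl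

𝟙-≤1 : (P? : Dec P) → 𝟙 P? ≤ 1
𝟙-≤1 (yes _) = ≤-refl
𝟙-≤1 (no _)  = z≤n

𝟙-cong : (P? : Dec P) (Q? : Dec Q) → (P → Q) → (Q → P) → 𝟙 P? ≡ 𝟙 Q?
𝟙-cong (yes p) Q? to from = sym (𝟙-yes Q? (to p))
𝟙-cong (no ¬p) Q? to from = sym (𝟙-no Q? (¬p ∘ from))

𝟙-× : (P? : Dec P) (Q? : Dec Q) → 𝟙 P? * 𝟙 Q? ≡ 𝟙 (P? ×-dec Q?)
𝟙-× (yes _) (yes _) = refl
𝟙-× (yes _) (no _)  = refl
𝟙-× (no _)  _       = refl

𝟙*-mono : (P? : Dec P) {a b : ℕ} → (P → a ≤ b) → 𝟙 P? * a ≤ 𝟙 P? * b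
𝟙*-mono (yes p) a≤b = *-monoʳ-≤ 1 (a≤b p)
𝟙*-mono (no _)  _   = z≤n

𝟙*-yes : (P? : Dec P) (a : ℕ) → P → 𝟙 P? * a ≡ a
𝟙*-yes P? a p = trans (cong (_* a) (𝟙-yes P? p)) (*-identityˡ a)

-- Since `P` holds for at most one index, the left side is 0 or 1, and in the latter case a single
-- witness of `Q` pays for it.
sum-𝟙-mono : {P : Fin m → Set} {Q : Fin n → Set} (P? : Decidable P) (Q? : Decidable Q) →
  (∀ {i j} → P i → P j → i ≡ j) → (∀ {i} → P i → ∃[ j ] Q j) →
  sum (𝟙 ∘ P?) ≤ sum (𝟙 ∘ Q?)
sum-𝟙-mono P? Q? unique P⇒Q with any? P?
... | no ¬p = ≤-trans (≤-reflexive (sum-zero (𝟙 ∘ P?) λ i → 𝟙-no (P? i) λ p → ¬p (i , p))) z≤n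
... | yes (i , p) with P⇒Q p
...   | j , q = begin
  sum (𝟙 ∘ P?)  ≡⟨ sum-single (𝟙 ∘ P?) i (λ k k≢i → 𝟙-no (P? k) λ p′ → k≢i (unique p′ p)) ⟩
  𝟙 (P? i)      ≤⟨ 𝟙-≤1 (P? i) ⟩
  1             ≡⟨ 𝟙-yes (Q? j) q ⟨
  𝟙 (Q? j)      ≤⟨ term≤sum (𝟙 ∘ Q?) j ⟩
  sum (𝟙 ∘ Q?)  ∎
  where open ≤-Reasoning

-- Cardinalities and restricted sums as sums of indicators

∣select∣ : {P : Fin n → Set} (P? : Decidable P) → ∣ select P? ∣ ≡ sum (𝟙 ∘ P?)
∣select∣ {zero}  P? = refl
∣select∣ {suc n} P? with does (P? zero)
... | true  = cong suc (∣select∣ (P? ∘ suc))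
... | false = ∣select∣ (P? ∘ suc)

∣∣-sum : (S : Subset n) → ∣ S ∣ ≡ sum (λ i → 𝟙 (i ∈? S))
∣∣-sum []          = refl
∣∣-sum (true ∷ S)  = cong suc (∣∣-sum S)
∣∣-sum (false ∷ S) = ∣∣-sum S

∑∈-sum : (S : Subset n) (g : Fin n → ℕ) → ∑∈ S g ≡ sum (λ x → 𝟙 (x ∈? S) * g x)
∑∈-sum {n} S g = go id
  where
  -- Generalised from `id` to any `k`, because the tail of `List.tabulate k` is the tabulation of
  -- `k ∘ suc`.
  go : (k : Fin m → Fin n) →
    ListAction.sum (List.map g (List.filter (_∈? S) (List.tabulate k))) ≡ sum (λ i → 𝟙 (k i ∈? S) * g (k i))
  go {zero}  k = refl
  go {suc m} k with does (k zero ∈? S)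
  ... | true  = cong₂ _+_ (sym (+-identityʳ (g (k zero)))) (go (k ∘ suc))
  ... | false = go (k ∘ suc)

∈-select⁺ : {P : Fin n → Set} (P? : Decidable P) {i : Fin n} → P i → i ∈ select P?
∈-select⁺ P? {i} p = lookup⇒[]= i _ (trans (lookup∘tabulate (does ∘ P?) i) (dec-true (P? i) p))

∈⇒∣∣>0 : {S : Subset n} {i : Fin n} → i ∈ S → 0 < ∣ S ∣
∈⇒∣∣>0 i∈S = ≤-trans (s≤s z≤n) (x∈p⇒∣p-x∣<∣p∣ i∈S)

∣∣≡0⇒∉ : {S : Subset n} {i : Fin n} → ∣ S ∣ ≡ 0 → i ∉ S
∣∣≡0⇒∉ ∣S∣≡0 i∈S = <⇒≱ (∈⇒∣∣>0 i∈S) (≤-reflexive ∣S∣≡0)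

Empty⇒∣∣≡0 : {S : Subset n} → Empty S → ∣ S ∣ ≡ 0
Empty⇒∣∣≡0 {n} ∅ = trans (cong ∣_∣ (Empty-unique ∅)) (∣⊥∣≡0 n)

∣∣>0⇒Nonempty : {S : Subset n} → 0 < ∣ S ∣ → Nonempty S
∣∣>0⇒Nonempty {S = S} 0<∣S∣ with nonempty? S
... | yes ne = ne
... | no  ∅  = contradiction (≤-reflexive (Empty⇒∣∣≡0 ∅)) (<⇒≱ 0<∣S∣)

∈∪⁅⁆⇒∈ : (S : Subset n) {i j : Fin n} → j ≢ i → j ∈ S ∪ ⁅ i ⁆ → j ∈ S
∈∪⁅⁆⇒∈ S {i} j≢i j∈ = [ id , (λ j∈i → contradiction (x∈⁅y⁆⇒x≡y i j∈i) j≢i) ]′ (x∈p∪q⁻ S ⁅ i ⁆ j∈)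

∪⁅⁆-⊆ : (S : Subset n) {i : Fin n} {S′ : Subset n} → S ⊆ S′ → i ∈ S′ → S ∪ ⁅ i ⁆ ⊆ S′
∪⁅⁆-⊆ S {i} {S′} S⊆S′ i∈S′ j∈ =
  [ S⊆S′ , (λ j∈i → subst (_∈ S′) (sym (x∈⁅y⁆⇒x≡y i j∈i)) i∈S′) ]′ (x∈p∪q⁻ S ⁅ i ⁆ j∈)

-- Degrees and multiplicities

module _ (G : Graph) where
  open Graph G

  μ-sum : ∀ u v → μ u v ≡ sum (λ e → 𝟙 (joins? u v e))
  μ-sum u v = ∣select∣ (joins? u v)

  joins-sym : ∀ {u v e} → Joins u v e → Joins v u e
  joins-sym = Sum.swap

  joins-unique : ∀ {t x y e} → Joins t x e → Joins t y e → x ≡ y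
  joins-unique (inj₁ (refl , refl)) (inj₁ (_ , refl))       = refl
  joins-unique (inj₁ (refl , refl)) (inj₂ (refl , tgt≡src)) = tgt≡src
  joins-unique (inj₂ (refl , refl)) (inj₁ (src≡tgt , refl)) = src≡tgt
  joins-unique (inj₂ (refl , refl)) (inj₂ (refl , _))       = refl

  μ-sym : ∀ u v → μ u v ≡ μ v u
  μ-sym u v = trans (μ-sum u v) (trans
    (sum-cong-≗ λ e → 𝟙-cong (joins? u v e) (joins? v u e) joins-sym joins-sym)
    (sym (μ-sum v u)))

  μ-zero : ∀ u v → (∀ e → ¬ Joins u v e) → μ u v ≡ 0
  μ-zero u v ¬joins = trans (μ-sum u v) (sum-zero _ λ e → 𝟙-no (joins? u v e) (¬joins e))

  joins-irrefl : ∀ {u e} → ¬ Joins u u e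
  joins-irrefl {e = e} (inj₁ (s , t)) = loopless e (trans s (sym t))
  joins-irrefl {e = e} (inj₂ (s , t)) = loopless e (trans s (sym t))

  Adjacent⇒μ>0 : ∀ (K : Subgraph G) {u v} → Adjacent K u v → 0 < μ u v
  Adjacent⇒μ>0 K (e , _ , je) = ∈⇒∣∣>0 (∈-select⁺ (joins? _ _) je)

  -- Double counting of the edges between `S` and `x`: by the end in `S` on the left, edge by edge
  -- on the right.
  weighted-μ : (S : Subset order) (x : Vertex) →
    sum (λ t → 𝟙 (t ∈? S) * μ t x) ≡ sum (λ e → sum (λ t → 𝟙 ((t ∈? S) ×-dec joins? t x e)))
  weighted-μ S x = begin
    sum (λ t → 𝟙 (t ∈? S) * μ t x)
      ≡⟨ sum-cong-≗ (λ t → trans (cong (𝟙 (t ∈? S) *_) (μ-sum t x)) (*-distribˡ-sum (𝟙 (t ∈? S)) (λ e → 𝟙 (joins? t x e)))) ⟩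
    sum (λ t → sum (λ e → 𝟙 (t ∈? S) * 𝟙 (joins? t x e)))
      ≡⟨ sum-cong-≗ (λ t → sum-cong-≗ λ e → 𝟙-× (t ∈? S) (joins? t x e)) ⟩
    sum (λ t → sum (λ e → 𝟙 ((t ∈? S) ×-dec joins? t x e)))
      ≡⟨ ∑-comm (λ t e → 𝟙 ((t ∈? S) ×-dec joins? t x e)) ⟩
    sum (λ e → sum (λ t → 𝟙 ((t ∈? S) ×-dec joins? t x e))) ∎
    where open ≡-Reasoning

  -- An edge at `x` has exactly one other end, and the two hypotheses say that it belongs to `K`
  -- precisely when that end lies in `S`. They fit both the whole graph and induced subgraphs.
  degree-sum : (K : Subgraph G) (S : Subset order) {x : Vertex} → x ∈ S →
    (∀ {e} → e ∈ edges K → src e ∈ S × tgt e ∈ S) →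
    (∀ {e} → src e ∈ S → tgt e ∈ S → e ∈ edges K) →
    degree K x ≡ sum (λ t → 𝟙 (t ∈? S) * μ t x)
  degree-sum K S {x} x∈S ends edge =
    trans (∣select∣ edge?) (trans (sum-cong-≗ pointwise) (sym (weighted-μ S x)))
    where
    edge? : ∀ e → Dec (e ∈ edges K × Incident e x)
    edge? e = (e ∈? edges K) ×-dec incident? e x

    only : ∀ {e y} → Joins y x e → (e ∈ edges K × Incident e x → y ∈ S) → (y ∈ S → e ∈ edges K × Incident e x) →
      𝟙 (edge? e) ≡ sum (λ t → 𝟙 ((t ∈? S) ×-dec joins? t x e))
    only {e} {y} je to from = trans
      (𝟙-cong (edge? e) ((y ∈? S) ×-dec joins? y x e) (λ p → to p , je) (from ∘ proj₁))
      (sym (sum-single _ y λ t t≢y → 𝟙-no ((t ∈? S) ×-dec joins? t x e)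
        λ { (_ , je′) → t≢y (joins-unique (joins-sym je′) (joins-sym je)) }))

    pointwise : ∀ e → 𝟙 (edge? e) ≡ sum (λ t → 𝟙 ((t ∈? S) ×-dec joins? t x e))
    pointwise e with incident? e x
    ... | yes (inj₁ refl) =
      only (inj₂ (refl , refl)) (λ p → proj₂ (ends (proj₁ p))) (λ y∈S → edge x∈S y∈S , inj₁ refl)
    ... | yes (inj₂ refl) =
      only (inj₁ (refl , refl)) (λ p → proj₁ (ends (proj₁ p))) (λ y∈S → edge y∈S x∈S , inj₂ refl)
    ... | no ¬inc = trans (𝟙-no (edge? e) (¬inc ∘ proj₂)) (sym (sum-zero _ λ t →
      𝟙-no ((t ∈? S) ×-dec joins? t x e) λ { (_ , inj₁ (_ , t≡x)) → ¬inc (inj₂ t≡x) ; (_ , inj₂ (s≡x , _)) → ¬inc (inj₁ s≡x) }))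

  d-sum : ∀ x → d G x ≡ sum (λ t → μ t x)
  d-sum x = trans (degree-sum (whole G) ⊤ ∈⊤ (λ _ → ∈⊤ , ∈⊤) (λ _ _ → ∈⊤))
    (sum-cong-≗ λ t → 𝟙*-yes (t ∈? ⊤) (μ t x) ∈⊤)

  ∈-edges-induced : (S : Subset order) → ∀ {e} → src e ∈ S → tgt e ∈ S → e ∈ edges (induced G S)
  ∈-edges-induced S s t = ∈-select⁺ (λ e → (src e ∈? S) ×-dec (tgt e ∈? S)) (s , t)

  -- The number of edges from `x` into `T`. It is the degree of `x` in the subgraph induced on
  -- `T ∪ ⁅ x ⁆`, whether or not `x ∈ T`, as there are no loops.
  nbrs : Subset order → Vertex → ℕ
  nbrs T x = sum (λ t → 𝟙 (t ∈? T) * μ t x)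

  degree-induced : (T : Subset order) (x : Vertex) → degree (induced G (T ∪ ⁅ x ⁆)) x ≡ nbrs T x
  degree-induced T x = trans
    (degree-sum (induced G T′) T′ (q⊆p∪q T _ (x∈⁅x⁆ x)) (closed (induced G T′)) (∈-edges-induced T′))
    (sum-cong-≗ pointwise)
    where
    T′ : Subset order
    T′ = T ∪ ⁅ x ⁆

    pointwise : ∀ t → 𝟙 (t ∈? T′) * μ t x ≡ 𝟙 (t ∈? T) * μ t x
    pointwise t with t ≟ x
    ... | yes refl = trans (vanish (𝟙 (t ∈? T′))) (sym (vanish (𝟙 (t ∈? T))))
      where
      vanish : ∀ k → k * μ t t ≡ 0
      vanish k = trans (cong (k *_) (μ-zero t t λ e → joins-irrefl)) (*-comm k 0)
    ... | no t≢x = cong (_* μ t x) (𝟙-cong (t ∈? T′) (t ∈? T) (∈∪⁅⁆⇒∈ T t≢x) (p⊆p∪q _))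

  degree-mono : (K L : Subgraph G) → K ⊑ L → ∀ x → degree K x ≤ degree L x
  degree-mono K L K⊑L x = p⊆q⇒∣p∣≤∣q∣ {p = select (at? K)} {q = select (at? L)} λ e∈ →
    let e∈K , inc = ∈-select⁻ (at? K) e∈ in ∈-select⁺ (at? L) (proj₂ K⊑L e∈K , inc)
    where
    at? : (J : Subgraph G) → ∀ e → Dec (e ∈ edges J × Incident e x)
    at? J e = (e ∈? edges J) ×-dec incident? e x

  degenerate-⊥ : ∀ f → StrictlyDegenerate f (induced G ⊥)
  degenerate-⊥ f K K⊑ (x , x∈K) = contradiction (proj₁ K⊑ x∈K) ∉⊥

  -- A subgraph that contains `x` has `x` itself as a vertex of small degree; one that avoids `x`
  -- already lies in the subgraph induced on `T`.
  degenerate-∪ : ∀ f T x → StrictlyDegenerate f (induced G T) → nbrs T x < f x →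
    StrictlyDegenerate f (induced G (T ∪ ⁅ x ⁆))
  degenerate-∪ f T x sd lt K K⊑ ne with x ∈? vertices K
  ... | yes x∈K = x , x∈K , ≤-trans (s≤s (≤-trans (degree-mono K (induced G (T ∪ ⁅ x ⁆)) K⊑ x) (≤-reflexive (degree-induced T x)))) lt
  ... | no  x∉K = sd K (vs⊆T , λ e∈K → let s , t = closed K e∈K in ∈-edges-induced T (vs⊆T s) (vs⊆T t)) ne
    where
    vs⊆T : vertices K ⊆ T
    vs⊆T y∈K = ∈∪⁅⁆⇒∈ T (λ { refl → x∉K y∈K }) (proj₁ K⊑ y∈K)

  -- Connectivity

  Closed : Subgraph G → Subset order → Set
  Closed K R = ∀ {a b} → a ∈ R → Adjacent K a b → b ∈ R

  closed-Star : ∀ K R {a b} → Closed K R → a ∈ R → Star (Adjacent K) a b → b ∈ R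
  closed-Star K R cl a∈R ε            = a∈R
  closed-Star K R cl a∈R (adj ◅ path) = closed-Star K R cl (cl a∈R adj) path

  adjacent? : ∀ K u v → Dec (Adjacent {G} K u v)
  adjacent? K u v = any? λ e → (e ∈? edges K) ×-dec joins? u v e

  -- Induction on ever larger sets: as long as `R` is not closed, some edge of `K` leaves it and its
  -- outer end `b` is added. It serves both to find reachable sets and to order the vertices for the
  -- greedy colouring.
  growth : (K : Subgraph G) (P : Subset order → Set) →
    (∀ R → Closed K R → P R) →
    (∀ R {a b} → a ∈ R → b ∉ R → Adjacent K a b → P (R ∪ ⁅ b ⁆) → P R) →
    ∀ R → P R
  growth K P base step R = go R (⊃-wellFounded R)
    where
    go : ∀ R → Acc _⊃_ R → P R
    go R (acc rec) with any? (λ a → any? λ b → (a ∈? R) ×-dec (¬? (b ∈? R) ×-dec adjacent? K a b))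
    ... | yes (a , b , a∈R , b∉R , adj) =
      step R a∈R b∉R adj (go (R ∪ ⁅ b ⁆) (rec (p⊆p∪q _ , b , q⊆p∪q R _ (x∈⁅x⁆ b) , b∉R)))
    ... | no none = base R closedR
      where
      closedR : Closed K R
      closedR {a} {b} a∈R adj with b ∈? R
      ... | yes b∈R = b∈R
      ... | no  b∉R = contradiction (a , b , a∈R , b∉R , adj) none

  adjacent-sym : ∀ K {u v} → Adjacent {G} K u v → Adjacent K v u
  adjacent-sym K (e , e∈K , je) = e , e∈K , joins-sym je

  adjacent-∈ : ∀ K {u v} → Adjacent {G} K u v → u ∈ vertices K × v ∈ vertices K
  adjacent-∈ K (e , e∈K , inj₁ (refl , refl)) = closed K e∈K
  adjacent-∈ K (e , e∈K , inj₂ (refl , refl)) = swap (closed K e∈K)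

  reachable-set : ∀ K {a} → a ∈ vertices K →
    ∃[ R ] (Closed K R × a ∈ R × R ⊆ vertices K × (∀ {b} → b ∈ R → Star (Adjacent K) a b))
  reachable-set K {a} a∈K = growth K Goal base step ⁅ a ⁆ (x∈⁅x⁆ a)
      (λ b∈ → subst (_∈ vertices K) (sym (x∈⁅y⁆⇒x≡y a b∈)) a∈K)
      (λ b∈ → subst (Star _ a) (sym (x∈⁅y⁆⇒x≡y a b∈)) ε)
    where
    Reach : Subset order → Set
    Reach R = ∀ {b} → b ∈ R → Star (Adjacent K) a b

    Goal : Subset order → Set
    Goal R₀ = a ∈ R₀ → R₀ ⊆ vertices K → Reach R₀ →
      ∃[ R ] (Closed K R × a ∈ R × R ⊆ vertices K × Reach R)

    base : ∀ R → Closed K R → Goal R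
    base R cl a∈R R⊆K reach = R , (λ {x} {y} → cl {x} {y}) , a∈R , R⊆K , reach

    step : ∀ R {b c} → b ∈ R → c ∉ R → Adjacent K b c → Goal (R ∪ ⁅ c ⁆) → Goal R
    step R {b} {c} b∈R _ adj goal a∈R R⊆K reach =
      goal (p⊆p∪q _ a∈R) (∪⁅⁆-⊆ R R⊆K (proj₂ (adjacent-∈ K adj))) reach′
      where
      reach′ : Reach (R ∪ ⁅ c ⁆)
      reach′ y∈ with x∈p∪q⁻ R ⁅ c ⁆ y∈
      ... | inj₁ y∈R = reach y∈R
      ... | inj₂ y∈c = subst (Star _ a) (sym (x∈⁅y⁆⇒x≡y c y∈c)) (reach b∈R ◅◅ adj ◅ ε)

  -- As `R` is closed, walks from `a` never leave it. Hence they survive in the subgraph induced on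
  -- `R`, and a connected `D` containing that subgraph is confined to `R`.
  reachable-component : ∀ S R {a} → Closed (induced G S) R → a ∈ R → R ⊆ S →
    (∀ {b} → b ∈ R → Star (Adjacent (induced G S)) a b) → Component (induced G S) (induced G R)
  reachable-component S R {a} cl a∈R R⊆S reach =
    (R⊆S , λ e∈ → let s , t = closed (induced G R) e∈ in ∈-edges-induced S (R⊆S s) (R⊆S t)) ,
    ((a , a∈R) , λ u∈R v∈R → reverse (adjacent-sym (induced G R)) (path u∈R) ◅◅ path v∈R) ,
    maximal
    where
    restrict : ∀ {u v} → u ∈ R → Star (Adjacent (induced G S)) u v → Star (Adjacent (induced G R)) u v
    restrict u∈R ε = ε
    restrict u∈R (adj@(e , _ , inj₁ (refl , refl)) ◅ p) =
      (e , ∈-edges-induced R u∈R (cl u∈R adj) , inj₁ (refl , refl)) ◅ restrict (cl u∈R adj) p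
    restrict u∈R (adj@(e , _ , inj₂ (refl , refl)) ◅ p) =
      (e , ∈-edges-induced R (cl u∈R adj) u∈R , inj₂ (refl , refl)) ◅ restrict (cl u∈R adj) p

    path : ∀ {b} → b ∈ R → Star (Adjacent (induced G R)) a b
    path b∈R = restrict a∈R (reach b∈R)

    maximal : ∀ D → D ⊑ induced G S → Connected D → induced G R ⊑ D → D ≐ induced G R
    maximal D D⊑S (_ , conn) R⊑D = ⊆-antisym vs (proj₁ R⊑D) ,
      ⊆-antisym (λ e∈D → let s , t = closed D e∈D in ∈-edges-induced R (vs s) (vs t)) (proj₂ R⊑D)
      where
      clD : Closed D R
      clD a∈R (e , e∈D , je) = cl a∈R (e , proj₂ D⊑S e∈D , je)

      vs : vertices D ⊆ R
      vs b∈D = closed-Star D R clD a∈R (conn (proj₁ R⊑D a∈R) b∈D)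

  -- If the set reached from `a` misses `b`, the sets reached from `a` and from `b` induce two
  -- different components, which makes `v` separating. Membership in the set is decidable, so the
  -- argument is constructive.
  nonseparating-connected : ∀ {v} → ¬ Separating G v → ∀ {a b} →
    a ∈ vertices (delete G v) → b ∈ vertices (delete G v) → Star (Adjacent (delete G v)) a b
  nonseparating-connected {v} ¬sep {a} {b} a∈ b∈
    with reachable-set (delete G v) a∈ | reachable-set (delete G v) b∈
  ... | R , clR , a∈R , R⊆ , reachR | Q , clQ , b∈Q , Q⊆ , reachQ with b ∈? R
  ...   | yes b∈R = reachR b∈R
  ...   | no  b∉R = contradiction
    (induced G R , induced G Q , reachable-component _ R clR a∈R R⊆ reachR , reachable-component _ Q clQ b∈Q Q⊆ reachQ ,
      λ R≐Q → b∉R (subst (b ∈_) (sym (proj₁ R≐Q)) b∈Q)) ¬sep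

-- Partial colourings

module _ (C : Configuration) where
  open Configuration C
  open IsCover isCover
  private module H = Graph H

  X-unique : ∀ {u v x} → x ∈ X u → x ∈ X v → u ≡ v
  X-unique {u} {v} x∈u x∈v with u ≟ v
  ... | yes u≡v = u≡v
  ... | no  u≢v = contradiction (_ , x∈p∩q⁺ (x∈u , x∈v)) (disjoint u≢v)

  -- Each of the `μG v u` matchings has at most one edge at `t`, and together they contain every
  -- edge from `t` to `X u`. For `u ≡ v` independence of the fibre leaves no edge at all.
  nbrs-fibre : ∀ {u v t} → t ∈ X v → nbrs H (X u) t ≤ μG v u
  nbrs-fibre {u} {v} {t} t∈v with v ≟ u
  ... | yes refl = ≤-trans (≤-reflexive (trans (weighted-μ H (X u) t)
      (sum-zero _ λ e → sum-zero _ λ x → 𝟙-no ((x ∈? X u) ×-dec H.joins? x t e) (unjoined e x)))) z≤n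
    where
    unjoined : ∀ e x → ¬ (x ∈ X u × H.Joins x t e)
    unjoined e x (x∈u , inj₁ (refl , refl)) = independent u e (x∈u , t∈v)
    unjoined e x (x∈u , inj₂ (refl , refl)) = independent u e (t∈v , x∈u)
  ... | no v≢u with matchings v≢u
  ...   | M , matching , covers = begin
    nbrs H (X u) t                              ≡⟨ weighted-μ H (X u) t ⟩
    sum (λ e → sum (λ x → 𝟙 (from? e x)))       ≤⟨ sum-mono-≤ _ _ (λ e → sum-𝟙-mono (from? e) (λ i → in? i e) unique matched) ⟩
    sum (λ e → sum (λ i → 𝟙 (in? i e)))         ≡⟨ ∑-comm (λ e i → 𝟙 (in? i e)) ⟩
    -- Comparison with an always true predicate on a one-element index type bounds the number of
    -- edges of `M i` at `t` by 1.
    sum (λ i → sum (λ e → 𝟙 (in? i e)))         ≤⟨ sum-mono-≤ _ _ (λ i → sum-𝟙-mono {n = 1} {Q = λ _ → Unit.⊤} (in? i) (λ _ → yes _) (one i) (λ _ → zero , _)) ⟩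
    sum {μG v u} (λ i → 1)                      ≡⟨ sum-ones (μG v u) ⟩
    μG v u                                      ∎
    where
    open ≤-Reasoning

    from? : ∀ e x → Dec (x ∈ X u × H.Joins x t e)
    from? e x = (x ∈? X u) ×-dec H.joins? x t e

    in? : ∀ i e → Dec (e ∈ M i × H.Incident e t)
    in? i e = (e ∈? M i) ×-dec H.incident? e t

    unique : ∀ {e x y} → x ∈ X u × H.Joins x t e → y ∈ X u × H.Joins y t e → x ≡ y
    unique (_ , jx) (_ , jy) = joins-unique H (joins-sym H jx) (joins-sym H jy)

    between : ∀ {e x} → x ∈ X u × H.Joins x t e → H.Between (X v) (X u) e × H.Incident e t
    between (x∈u , inj₁ (refl , refl)) = inj₂ (x∈u , t∈v) , inj₂ refl
    between (x∈u , inj₂ (refl , refl)) = inj₁ (t∈v , x∈u) , inj₁ refl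

    matched : ∀ {e x} → x ∈ X u × H.Joins x t e → ∃[ i ] (e ∈ M i × H.Incident e t)
    matched p = let btw , inc = between p ; i , e∈ = Equivalence.to (covers _) btw in i , e∈ , inc

    one : ∀ i {e e′} → e ∈ M i × H.Incident e t → e′ ∈ M i × H.Incident e′ t → e ≡ e′
    one i {e} {e′} (e∈ , inc) (e′∈ , inc′) with e ≟ e′
    ... | yes e≡e′ = e≡e′
    ... | no  e≢e′ = contradiction (inc , inc′) (matching i e∈ e′∈ e≢e′ t)

  -- The number of edges of `H` between `T ∩ X v` and `X u`.
  cross : Subset ∣H∣ → Graph.Vertex G → Graph.Vertex G → ℕ
  cross T u v = sum (λ t → 𝟙 (t ∈? (T ∩ X v)) * nbrs H (X u) t)

  ∣∣*-sum : (S : Subset ∣H∣) (k : ℕ) → sum (λ t → 𝟙 (t ∈? S) * k) ≡ ∣ S ∣ * k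
  ∣∣*-sum S k = trans (sym (*-distribʳ-sum k (λ t → 𝟙 (t ∈? S)))) (cong (_* k) (sym (∣∣-sum S)))

  fibre-term : ∀ T u v t → 𝟙 (t ∈? (T ∩ X v)) * nbrs H (X u) t ≤ 𝟙 (t ∈? (T ∩ X v)) * μG v u
  fibre-term T u v t = 𝟙*-mono (t ∈? (T ∩ X v)) (λ t∈ → nbrs-fibre (proj₂ (x∈p∩q⁻ T (X v) t∈)))

  cross-≤ : ∀ T u v → cross T u v ≤ ∣ T ∩ X v ∣ * μG v u
  cross-≤ T u v = ≤-trans (sum-mono-≤ _ _ (fibre-term T u v)) (≤-reflexive (∣∣*-sum (T ∩ X v) (μG v u)))

  -- The edges between `X u` and `T` are counted first from their ends in `X u`, then from their
  -- ends in `T`, the latter sorted by the fibres that cover them.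
  ∑nbrs≤cross : ∀ T u → ∑[ x ∈ X u ] nbrs H T x ≤ sum (cross T u)
  ∑nbrs≤cross T u = begin
    ∑[ x ∈ X u ] nbrs H T x
      ≡⟨ ∑∈-sum (X u) (nbrs H T) ⟩
    sum (λ x → 𝟙 (x ∈? X u) * sum (λ t → 𝟙 (t ∈? T) * μH t x))
      ≡⟨ sum-cong-≗ (λ x → *-distribˡ-sum (𝟙 (x ∈? X u)) (λ t → 𝟙 (t ∈? T) * μH t x)) ⟩
    sum (λ x → sum (λ t → 𝟙 (x ∈? X u) * (𝟙 (t ∈? T) * μH t x)))
      ≡⟨ ∑-comm (λ x t → 𝟙 (x ∈? X u) * (𝟙 (t ∈? T) * μH t x)) ⟩
    sum (λ t → sum (λ x → 𝟙 (x ∈? X u) * (𝟙 (t ∈? T) * μH t x)))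
      ≡⟨ sum-cong-≗ (λ t → trans (sum-cong-≗ (λ x → rearrange x t)) (sym (*-distribˡ-sum (𝟙 (t ∈? T)) (λ x → 𝟙 (x ∈? X u) * μH x t)))) ⟩
    sum (λ t → 𝟙 (t ∈? T) * nbrs H (X u) t)
      ≤⟨ sum-mono-≤ _ _ split ⟩
    sum (λ t → sum (λ v → 𝟙 (t ∈? (T ∩ X v)) * nbrs H (X u) t))
      ≡⟨ ∑-comm (λ t v → 𝟙 (t ∈? (T ∩ X v)) * nbrs H (X u) t) ⟩
    sum (cross T u) ∎
    where
    open ≤-Reasoning

    rearrange : ∀ x t → 𝟙 (x ∈? X u) * (𝟙 (t ∈? T) * μH t x) ≡ 𝟙 (t ∈? T) * (𝟙 (x ∈? X u) * μH x t)
    rearrange x t = trans (sym (*-assoc (𝟙 (x ∈? X u)) (𝟙 (t ∈? T)) (μH t x)))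
      (trans (cong₂ _*_ (*-comm (𝟙 (x ∈? X u)) (𝟙 (t ∈? T))) (μ-sym H t x))
        (*-assoc (𝟙 (t ∈? T)) (𝟙 (x ∈? X u)) (μH x t)))

    split : ∀ t → 𝟙 (t ∈? T) * nbrs H (X u) t ≤ sum (λ v → 𝟙 (t ∈? (T ∩ X v)) * nbrs H (X u) t)
    split t with covering t
    ... | v , t∈v = ≤-trans
      (≤-reflexive (cong (_* nbrs H (X u) t)
        (𝟙-cong (t ∈? T) (t ∈? (T ∩ X v)) (λ t∈T → x∈p∩q⁺ (t∈T , t∈v)) (proj₁ ∘ x∈p∩q⁻ T (X v)))))
      (term≤sum (λ v → 𝟙 (t ∈? (T ∩ X v)) * nbrs H (X u) t) v)

  -- A partial transversal whose domain is the complement of `R`. It is phrased by cardinalities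
  -- because `∣ T ∩ X v ∣` occurs as the coefficient of `μG v u` in the degree counts.
  record Colouring (R : Subset ∣G∣) (T : Subset ∣H∣) : Set where
    field
      uncoloured : ∀ {v} → v ∈ R → ∣ T ∩ X v ∣ ≡ 0
      coloured   : ∀ {v} → v ∉ R → ∣ T ∩ X v ∣ ≡ 1
      degenerate : StrictlyDegenerate f (induced H T)

    partial : PartialTransversal T
    partial v with v ∈? R
    ... | yes v∈R = ≤-trans (≤-reflexive (uncoloured v∈R)) z≤n
    ... | no  v∉R = ≤-reflexive (coloured v∉R)

  open Colouring

  colouring-⊤ : Colouring ⊤ ⊥
  colouring-⊤ = record
    { uncoloured = λ {v} _ → Empty⇒∣∣≡0 λ { (x , x∈) → ∉⊥ (proj₁ (x∈p∩q⁻ ⊥ (X v) x∈)) }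
    ; coloured   = λ v∉⊤ → contradiction ∈⊤ v∉⊤
    ; degenerate = degenerate-⊥ H f
    }

  -- Fibres are disjoint, so adding `x` changes only the count in `X w`, from 0 to 1; degeneracy
  -- survives by `degenerate-∪`.
  extend : ∀ {R T w x} → w ∉ R → Colouring (R ∪ ⁅ w ⁆) T → x ∈ X w → nbrs H T x < f x → Colouring R (T ∪ ⁅ x ⁆)
  extend {R} {T} {w} {x} w∉R c x∈w lt = record
    { uncoloured = λ {v} v∈R → trans (cong ∣_∣ (other (λ { refl → w∉R v∈R }))) (uncoloured c (p⊆p∪q _ v∈R))
    ; coloured   = λ {v} → coloured′ v
    ; degenerate = degenerate-∪ H f T x (degenerate c) lt
    }
    where
    other : ∀ {v} → v ≢ w → (T ∪ ⁅ x ⁆) ∩ X v ≡ T ∩ X v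
    other {v} v≢w = ⊆-antisym to (λ y∈ → let y∈T , y∈v = x∈p∩q⁻ T (X v) y∈ in x∈p∩q⁺ (p⊆p∪q _ y∈T , y∈v))
      where
      to : (T ∪ ⁅ x ⁆) ∩ X v ⊆ T ∩ X v
      to y∈ = let y∈T′ , y∈v = x∈p∩q⁻ (T ∪ ⁅ x ⁆) (X v) y∈ in
        x∈p∩q⁺ (∈∪⁅⁆⇒∈ T (λ { refl → v≢w (X-unique y∈v x∈w) }) y∈T′ , y∈v)

    same : (T ∪ ⁅ x ⁆) ∩ X w ≡ ⁅ x ⁆
    same = ⊆-antisym to λ y∈x → subst (_∈ (T ∪ ⁅ x ⁆) ∩ X w) (sym (x∈⁅y⁆⇒x≡y x y∈x))
        (x∈p∩q⁺ (q⊆p∪q T _ (x∈⁅x⁆ x) , x∈w))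
      where
      to : (T ∪ ⁅ x ⁆) ∩ X w ⊆ ⁅ x ⁆
      to y∈ with x∈p∩q⁻ (T ∪ ⁅ x ⁆) (X w) y∈
      ... | y∈T′ , y∈w with x∈p∪q⁻ T ⁅ x ⁆ y∈T′
      ...   | inj₁ y∈T = contradiction (x∈p∩q⁺ (y∈T , y∈w)) (∣∣≡0⇒∉ (uncoloured c (q⊆p∪q R _ (x∈⁅x⁆ w))))
      ...   | inj₂ y∈x = y∈x

    coloured′ : ∀ v → v ∉ R → ∣ (T ∪ ⁅ x ⁆) ∩ X v ∣ ≡ 1
    coloured′ v v∉R with v ≟ w
    ... | yes refl = trans (cong ∣_∣ same) (∣⁅x⁆∣≡1 x)
    ... | no  v≢w  = trans (cong ∣_∣ (other v≢w)) (coloured c (v∉R ∘ ∈∪⁅⁆⇒∈ R v≢w))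

  ∣∩∣*μ≤μ : ∀ {R T} → Colouring R T → ∀ u v → ∣ T ∩ X v ∣ * μG v u ≤ μG v u
  ∣∩∣*μ≤μ c u v = ≤-trans (*-monoˡ-≤ (μG v u) (partial c v)) (≤-reflexive (*-identityˡ _))

  -- Greedy colouring under degree-feasibility

  module _ (feasible : DegreeFeasible) where

    -- An uncoloured neighbour r of w leaves slack in the degree count at w.
    free-colour : ∀ {R T r w} → Colouring R T → r ∈ R → 0 < μG r w → ∃[ x ] (x ∈ X w × nbrs H T x < f x)
    free-colour {R} {T} {r} {w} c r∈R r~w with any? (λ x → (x ∈? X w) ×-dec (nbrs H T x <? f x))
    ... | yes free = free
    ... | no  none = contradiction chain (<-irrefl refl)
      where
      open ≤-Reasoning

      chain : d G w < d G w
      chain = begin-strict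
        d G w                                     ≤⟨ feasible w ⟩
        ∑[ x ∈ X w ] f x                          ≡⟨ ∑∈-sum (X w) f ⟩
        sum (λ x → 𝟙 (x ∈? X w) * f x)            ≤⟨ sum-mono-≤ _ _ (λ x → 𝟙*-mono (x ∈? X w) λ x∈ → ≮⇒≥ λ lt → none (x , x∈ , lt)) ⟩
        sum (λ x → 𝟙 (x ∈? X w) * nbrs H T x)     ≡⟨ ∑∈-sum (X w) (nbrs H T) ⟨
        ∑[ x ∈ X w ] nbrs H T x                   ≤⟨ ∑nbrs≤cross T w ⟩
        sum (cross T w)                           ≤⟨ sum-mono-≤ _ _ (cross-≤ T w) ⟩
        sum (λ v → ∣ T ∩ X v ∣ * μG v w)          <⟨ sum-mono-< _ _ (∣∩∣*μ≤μ c w) r (subst (λ k → k * μG r w < μG r w) (sym (uncoloured c r∈R)) r~w) ⟩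
        sum (λ v → μG v w)                        ≡⟨ d-sum G w ⟨
        d G w                                     ∎

    -- The set of uncoloured vertices is grown from `⁅ u ⁆` to all of `K`, where `T₀` is available.
    -- Unwinding the induction colours the added vertices in reverse order, ends with only `u`
    -- uncoloured, and keeps everything chosen in `T₀`.
    greedy : (K : Subgraph G) {u : Graph.Vertex G} → u ∈ vertices K →
      (∀ {w} → w ∈ vertices K → Star (Adjacent K) u w) →
      ∀ {T₀} → Colouring (vertices K) T₀ → ∃[ T ] (T₀ ⊆ T × Colouring ⁅ u ⁆ T)
    greedy K {u} u∈K conn {T₀} c₀ = growth G K Goal base step ⁅ u ⁆ (x∈⁅x⁆ u)
        (λ v∈ → subst (_∈ vertices K) (sym (x∈⁅y⁆⇒x≡y u v∈)) u∈K)
      where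
      Goal : Subset ∣G∣ → Set
      Goal R = u ∈ R → R ⊆ vertices K → ∃[ T ] (T₀ ⊆ T × Colouring R T)

      base : ∀ R → Closed G K R → Goal R
      base R cl u∈R R⊆K = T₀ , id ,
        -- A closed set containing `u` exhausts `K`, since all of `K` is reachable from `u`.
        subst (λ S → Colouring S T₀) (⊆-antisym (λ w∈K → closed-Star G K R cl u∈R (conn w∈K)) R⊆K) c₀

      step : ∀ R {a b} → a ∈ R → b ∉ R → Adjacent K a b → Goal (R ∪ ⁅ b ⁆) → Goal R
      step R a∈R b∉R adj goal u∈R R⊆K
        with goal (p⊆p∪q _ u∈R) (∪⁅⁆-⊆ R R⊆K (proj₂ (adjacent-∈ G K adj)))
      -- The vertex `a` from which `b` was reached is still uncoloured when `b` receives its colour.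
      ... | T , T₀⊆T , c with free-colour c (p⊆p∪q _ a∈R) (Adjacent⇒μ>0 G K adj)
      ...   | x , x∈b , lt = T ∪ ⁅ x ⁆ , p⊆p∪q _ ∘ T₀⊆T , extend b∉R c x∈b lt

    -- Equality when a single vertex is left uncoloured

    module _ (uncolorable : Uncolorable) {u : Graph.Vertex G} {T : Subset ∣H∣} (c : Colouring ⁅ u ⁆ T) where

      -- Otherwise `extend` would add `x` to `T` and leave no vertex uncoloured, giving a degenerate
      -- transversal.
      f≤nbrs : ∀ {x} → x ∈ X u → f x ≤ nbrs H T x
      f≤nbrs {x} x∈u = ≮⇒≥ λ lt →
        let c′ = extend ∉⊥ (subst (λ S → Colouring S T) (sym (∪-identityˡ ⁅ u ⁆)) c) x∈u lt
        in uncolorable (T ∪ ⁅ x ⁆ , (λ v → coloured c′ ∉⊥) , degenerate c′)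

      -- These inequalities close up to the cycle
      -- d u ≤ ∑ f ≤ ∑ nbrs ≤ ∑ cross ≤ ∑ ∣ T ∩ X v ∣ * μ ≤ d u.
      ∑f≤∑nbrs : ∑[ x ∈ X u ] f x ≤ ∑[ x ∈ X u ] nbrs H T x
      ∑f≤∑nbrs = begin
        ∑[ x ∈ X u ] f x                       ≡⟨ ∑∈-sum (X u) f ⟩
        sum (λ x → 𝟙 (x ∈? X u) * f x)         ≤⟨ sum-mono-≤ _ _ (λ x → 𝟙*-mono (x ∈? X u) f≤nbrs) ⟩
        sum (λ x → 𝟙 (x ∈? X u) * nbrs H T x)  ≡⟨ ∑∈-sum (X u) (nbrs H T) ⟨
        ∑[ x ∈ X u ] nbrs H T x                ∎
        where open ≤-Reasoning

      ∑∣∩∣μ≤d : sum (λ v → ∣ T ∩ X v ∣ * μG v u) ≤ d G u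
      ∑∣∩∣μ≤d = ≤-trans (sum-mono-≤ _ _ (∣∩∣*μ≤μ c u)) (≤-reflexive (sym (d-sum G u)))

      ∑cross≤d : sum (cross T u) ≤ d G u
      ∑cross≤d = ≤-trans (sum-mono-≤ _ _ (cross-≤ T u)) ∑∣∩∣μ≤d

      ∑f≡d : ∑[ x ∈ X u ] f x ≡ d G u
      ∑f≡d = ≤-antisym (≤-trans ∑f≤∑nbrs (≤-trans (∑nbrs≤cross T u) ∑cross≤d)) (feasible u)

      -- Equality in the step from `∑ f` to `∑ nbrs` of the cycle, read off termwise.
      f≡nbrs : ∀ {x} → x ∈ X u → f x ≡ nbrs H T x
      f≡nbrs {x} x∈u = begin
        f x                          ≡⟨ 𝟙*-yes (x ∈? X u) (f x) x∈u ⟨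
        𝟙 (x ∈? X u) * f x           ≡⟨ sum-squeeze _ _ (λ y → 𝟙*-mono (y ∈? X u) f≤nbrs) ∑nbrs≤∑f x ⟩
        𝟙 (x ∈? X u) * nbrs H T x    ≡⟨ 𝟙*-yes (x ∈? X u) _ x∈u ⟩
        nbrs H T x                   ∎
        where
        open ≡-Reasoning

        ∑nbrs≤∑f : sum (λ y → 𝟙 (y ∈? X u) * nbrs H T y) ≤ sum (λ y → 𝟙 (y ∈? X u) * f y)
        ∑nbrs≤∑f = ≤-trans (≤-reflexive (sym (∑∈-sum (X u) (nbrs H T))))
          (≤-trans (∑nbrs≤cross T u) (≤-trans ∑cross≤d (≤-trans (feasible u) (≤-reflexive (∑∈-sum (X u) f)))))

      -- Two squeezes in succession: one over the vertices `v` of `G`, making each `cross T u v`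
      -- tight, and one over the vertices of the fibre of `v`.
      nbrs-fibre≡μ : ∀ {v t} → t ∈ T → t ∈ X v → nbrs H (X u) t ≡ μG v u
      nbrs-fibre≡μ {v} {t} t∈T t∈v = begin
        nbrs H (X u) t                           ≡⟨ 𝟙*-yes (t ∈? (T ∩ X v)) _ t∈ ⟨
        𝟙 (t ∈? (T ∩ X v)) * nbrs H (X u) t      ≡⟨ sum-squeeze _ _ (fibre-term T u v) (≤-reflexive (trans (∣∣*-sum (T ∩ X v) (μG v u)) (sym tight))) t ⟩
        𝟙 (t ∈? (T ∩ X v)) * μG v u              ≡⟨ 𝟙*-yes (t ∈? (T ∩ X v)) _ t∈ ⟩
        μG v u                                   ∎
        where
        open ≡-Reasoning

        t∈ : t ∈ T ∩ X v
        t∈ = x∈p∩q⁺ (t∈T , t∈v)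

        tight : cross T u v ≡ ∣ T ∩ X v ∣ * μG v u
        -- The reverse inequality of sums follows the cycle the other way round, through `d G u`.
        tight = sum-squeeze _ _ (cross-≤ T u)
          (≤-trans ∑∣∩∣μ≤d (≤-trans (feasible u) (≤-trans ∑f≤∑nbrs (∑nbrs≤cross T u)))) v

      -- The value `f y` counts all edges from `y` into `T`, and those to `t` are among them.
      μ≤f : ∀ {t y} → t ∈ T → y ∈ X u → μH y t ≤ f y
      μ≤f {t} {y} t∈T y∈u = begin
        μH y t                  ≡⟨ μ-sym H y t ⟩
        μH t y                  ≡⟨ 𝟙*-yes (t ∈? T) _ t∈T ⟨
        𝟙 (t ∈? T) * μH t y     ≤⟨ term≤sum (λ t → 𝟙 (t ∈? T) * μH t y) t ⟩
        nbrs H T y              ≡⟨ f≡nbrs y∈u ⟨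
        f y                     ∎
        where open ≤-Reasoning

      dom≡ : dom T ≡ vertices (delete G u)
      dom≡ = ⊆-antisym
        (λ {v} v∈dom → x∉p⇒x∈∁p λ v∈u → let y , y∈ = ∈-select⁻ (λ v → nonempty? (X v ∩ T)) v∈dom in
          ∣∣≡0⇒∉ (uncoloured c v∈u) (x∈p∩q⁺ (swap (x∈p∩q⁻ (X v) T y∈))))
        (λ {v} v∈ → let y , y∈ = ∣∣>0⇒Nonempty (≤-reflexive (sym (coloured c (x∈∁p⇒x∉p v∈)))) in
          ∈-select⁺ (λ v → nonempty? (X v ∩ T)) (y , x∈p∩q⁺ (swap (x∈p∩q⁻ T (X v) y∈))))

  -- Statement (c) speaks of every such `T`, not only of the greedy one; this makes the equality
  -- analysis apply to all of them.
  transversal-colouring : ∀ {T u} → PartialTransversal T → dom T ≡ vertices (delete G u) →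
    StrictlyDegenerate f (induced H T) → Colouring ⁅ u ⁆ T
  transversal-colouring {T} {u} pt dom≡∁u sd = record
    { uncoloured = λ {v} v∈u → Empty⇒∣∣≡0 λ { (y , y∈) → x∈p⇒x∉∁p v∈u (subst (v ∈_) dom≡∁u
        (∈-select⁺ (λ v → nonempty? (X v ∩ T)) (y , x∈p∩q⁺ (swap (x∈p∩q⁻ T (X v) y∈))))) }
    ; coloured   = λ {v} v∉u →
        let y , y∈ = ∈-select⁻ (λ v → nonempty? (X v ∩ T)) (subst (v ∈_) (sym dom≡∁u) (x∉p⇒x∈∁p v∉u))
        in ≤-antisym (pt v) (∈⇒∣∣>0 (x∈p∩q⁺ (swap (x∈p∩q⁻ (X v) T y∈))))
    ; degenerate = sd
    }

  nbrs-⊥ : ∀ x → nbrs H ⊥ x ≡ 0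
  nbrs-⊥ x = sum-zero _ λ t → cong (_* μH t x) (𝟙-no (t ∈? ⊥) ∉⊥)

-- Derivation of the three statements

proposition13 : (C : Configuration) → let open Configuration C in
    Connected (whole G) → DegreeFeasible → Uncolorable →
    (∀ u → ∑[ x ∈ X u ] f x ≡ d G u)
    ×
    (∀ v → ¬ Separating G v → ∀ xᵥ → xᵥ ∈ X v → f xᵥ > 0 →
    ∀ u → u ∈ vertices (delete G v) →
    (∀ y → y ∈ X u → f y ≥ μH y xᵥ) × μG v u ≡ ∑[ y ∈ X u ] μH y xᵥ)
    ×
    (∣G∣ ≥ 2 → ∀ u →
    (∃[ T ] (PartialTransversal T × dom T ≡ vertices (delete G u) × StrictlyDegenerate f (induced H T)))
    ×
    (∀ T → PartialTransversal T → dom T ≡ vertices (delete G u) → StrictlyDegenerate f (induced H T) →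
    ∀ x → x ∈ X u → f x ≡ degree (induced H (T ∪ ⁅ x ⁆)) x))
proposition13 C connected feasible uncolorable =
  (λ u → ∑f≡d C feasible uncolorable (proj₂ (proj₂ (root u)))) ,
  partB ,
  λ _ u → (let T , _ , c = root u in T , Colouring.partial c , dom≡ C feasible uncolorable c , Colouring.degenerate c) ,
    λ T pt dom≡∁u sd x x∈u → trans
      (f≡nbrs C feasible uncolorable (transversal-colouring C pt dom≡∁u sd) x∈u)
      (sym (degree-induced H T x))
  where
  open Configuration C

  root : ∀ u → ∃[ T ] (⊥ ⊆ T × Colouring C ⁅ u ⁆ T)
  root u = greedy C feasible (whole G) ∈⊤ (λ w∈ → proj₂ connected ∈⊤ w∈) (colouring-⊤ C)

  partB : ∀ v → ¬ Separating G v → ∀ xᵥ → xᵥ ∈ X v → f xᵥ > 0 →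
    ∀ u → u ∈ vertices (delete G v) →
    (∀ y → y ∈ X u → f y ≥ μH y xᵥ) × μG v u ≡ ∑[ y ∈ X u ] μH y xᵥ
  partB v ¬sep xᵥ xᵥ∈v fxᵥ>0 u u∈
    -- First `v` receives `xᵥ`: nothing has been chosen yet, so `xᵥ` has 0 chosen neighbours, fewer
    -- than `f xᵥ`. The uncoloured set is then the vertex set of `delete G v`, which is connected
    -- and is coloured towards `u`.
    with greedy C feasible (delete G v) u∈ (λ w∈ → nonseparating-connected G ¬sep u∈ w∈)
      (extend C (x∈p⇒x∉∁p (x∈⁅x⁆ v)) (subst (λ S → Colouring C S ⊥) (sym (∪-inverseˡ ⁅ v ⁆)) (colouring-⊤ C)) xᵥ∈v
        (subst (_< f xᵥ) (sym (nbrs-⊥ C xᵥ)) fxᵥ>0))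
  ... | T , T₀⊆T , c =
    (λ y y∈u → μ≤f C feasible uncolorable c xᵥ∈T y∈u) ,
    -- By definition `nbrs H (X u) xᵥ` is the indicator form of the sum of `μH y xᵥ` over `X u`.
    trans (sym (nbrs-fibre≡μ C feasible uncolorable c xᵥ∈T xᵥ∈v)) (sym (∑∈-sum (X u) (λ y → μH y xᵥ)))
    where
    xᵥ∈T : xᵥ ∈ T
    xᵥ∈T = T₀⊆T (q⊆p∪q ⊥ _ (x∈⁅x⁆ xᵥ))
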